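{- Let $m\ge 3$ and $n\ge 1$ be integers. The closeness of the lollipop graph $L_{m,n}$ is $$C(L_{m,n}) = \frac{m\left(m+1-2^{1-n}\right)}{2} + 2n + 3\cdot 2^{ -n} - 3 .$$
   Context: All graphs are finite, simple and undirected. The closeness of a graph $G$ is $C(G)=\sum_{i}\sum_{j\ne i}2^{ -d(i,j)}$, where $i,j$ range over the vertices of $G$ (ordered pairs), $d(i,j)$ is the distance between $i$ and $j$ in $G$, and the term $2^{ -d(i,j)}$ is $0$ if $i$ and $j$ lie in different connected components. The lollipop graph $L_{m,n}$ ($m\ge 3$, $n\ge 1$) has $m+n$ vertices $v_1,\dots,v_{m+n}$: the vertices $v_1,\dots,v_m$ form a complete graph $K_m$, the vertices $v_{m+1},\dots,v_{m+n}$ form a path $P_n$ (with links $(v_{m+i},v_{m+i+1})$, $1\le i\le n-1$), and there is one further link, the bridge $(v_m,v_{m+1})$. -}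

module Defs where

open import Data.Bool.Base using (if_then_else_)
open import Data.Fin.Base as Fin using (Fin; zero; suc; toℕ)
open import Data.Fin.Properties as Fin using (any?; pigeonhole; toℕ<n)
open import Data.Integer.Base as ℤ using (ℤ; +_; -[1+_])
open import Data.Nat.Base as ℕ using (ℕ; zero; suc; _≤_; _<_; s≤s)
open import Data.Nat.Induction using (<-rec)
import Data.Nat.Properties as ℕ
open import Data.Product.Base using (∃; _×_; _,_)
open import Data.Rational.Base using (ℚ; 0ℚ; ½; _/_; +-*-rawSemiring)
open import Data.Rational.Properties using (+-0-commutativeMonoid)
open import Data.Sum.Base using (_⊎_; inj₁; inj₂)
open import Level using (0ℓ)
open import Relation.Binary.Core using (Rel)
open import Relation.Binary.Definitions using (Decidable; Symmetric; Irreflexive)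
open import Relation.Binary.PropositionalEquality
  using (_≡_; _≢_; refl; sym; subst)
open import Relation.Nullary using (¬_; Dec; yes; no; does)
open import Relation.Nullary.Decidable using (_×-dec_; _⊎-dec_; ¬?; map′)

open import Algebra.Definitions.RawSemiring +-*-rawSemiring using (_^_)
open import Algebra.Properties.CommutativeMonoid.Sum +-0-commutativeMonoid
  using (sum-syntax)

fromℕ : ℕ → ℚ
fromℕ k = + k / 1

2^_ : ℤ → ℚ
2^ (+ k)    = fromℕ 2 ^ k
2^ -[1+ k ] = ½ ^ suc k

infixr 8 2^_

record Graph (N : ℕ) : Set₁ where
  field
    Adj     : Rel (Fin N) 0ℓ
    adj?    : Decidable Adj
    symm    : Symmetric Adj
    irrefl  : Irreflexive _≡_ Adj

module _ {N : ℕ} (G : Graph N) where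
  open Graph G

  infixr 5 _∷_

  data Walk : ℕ → Fin N → Fin N → Set where
    []  : ∀ {i} → Walk 0 i i
    _∷_ : ∀ {k i j l} → Adj i j → Walk k j l → Walk (suc k) i l

  Connected : Fin N → Fin N → Set
  Connected i j = ∃ λ k → Walk k i j

  IsDistance : Fin N → Fin N → ℕ → Set
  IsDistance i j d = Walk d i j × (∀ k → Walk k i j → d ≤ k)

module _ {N : ℕ} {G : Graph N} where
  open Graph G

  walk? : ∀ k i j → Dec (Walk G k i j)
  walk? zero i j = map′ (λ { refl → [] }) (λ { [] → refl }) (i Fin.≟ j)
  walk? (suc k) i j =
    map′ (λ { (l , a , w) → a ∷ w }) (λ { (a ∷ w) → _ , a , w })
         (any? λ l → adj? i l ×-dec walk? k l j)

  vertex : ∀ {k i j} → Walk G k i j → Fin (suc k) → Fin N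
  vertex {i = i} w       zero    = i
  vertex         (a ∷ w) (suc p) = vertex w p

  takeWalk : ∀ {k i j} (w : Walk G k i j) p → Walk G (toℕ p) i (vertex w p)
  takeWalk w       zero    = []
  takeWalk (a ∷ w) (suc p) = a ∷ takeWalk w p

  dropWalk : ∀ {k i j} (w : Walk G k i j) p → Walk G (k ℕ.∸ toℕ p) (vertex w p) j
  dropWalk w       zero    = w
  dropWalk (a ∷ w) (suc p) = dropWalk w p

  _++_ : ∀ {k l i j h} → Walk G k i j → Walk G l j h → Walk G (k ℕ.+ l) i h
  []      ++ v = v
  (a ∷ w) ++ v = a ∷ (w ++ v)

  shorten : ∀ {k i j} → N ≤ k → Walk G k i j → ∃ λ l → l < k × Walk G l i j
  shorten {k} {i} {j} N≤k w with pigeonhole (s≤s N≤k) (vertex w)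
  ... | p , q , p<q , eq =
    toℕ p ℕ.+ (k ℕ.∸ toℕ q) ,
    subst (toℕ p ℕ.+ (k ℕ.∸ toℕ q) <_)
          (ℕ.m+[n∸m]≡n (ℕ.≤-pred (toℕ<n q)))
          (ℕ.+-monoˡ-< (k ℕ.∸ toℕ q) p<q) ,
    takeWalk w p ++ subst (λ v → Walk G _ v j) (sym eq) (dropWalk w q)

  minimal : ∀ {i j} k → Walk G k i j → ∃ (IsDistance G i j)
  minimal {i} {j} = <-rec _ step
    where
    step : ∀ k → (∀ {l} → l < k → Walk G l i j → ∃ (IsDistance G i j)) →
           Walk G k i j → ∃ (IsDistance G i j)
    step k rec w with ℕ.anyUpTo? (λ l → walk? l i j) k
    ... | yes (l , l<k , v) = rec l<k v
    ... | no none = k , w , λ l v → ℕ.≮⇒≥ λ l<k → none (l , l<k , v)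

-- A shortest walk has length less than N, so only such lengths are searched.
distance : ∀ {N} (G : Graph N) (i j : Fin N) →
           ∃ (IsDistance G i j) ⊎ ¬ Connected G i j
distance {N} G i j with ℕ.anyUpTo? (λ l → walk? {G = G} l i j) N
... | yes (l , _ , w) = inj₁ (minimal l w)
... | no none = inj₂ λ (k , w) → disconnected k w
  where
  disconnected : ∀ k → ¬ Walk G k i j
  disconnected = <-rec _ λ k rec w → case-≤ k rec w (k ℕ.<? N)
    where
    case-≤ : ∀ k → (∀ {l} → l < k → ¬ Walk G l i j) → Walk G k i j →
             ¬ Dec (k < N)
    case-≤ k rec w (yes k<N) = none (k , k<N , w)
    case-≤ k rec w (no k≮N) with shorten (ℕ.≮⇒≥ k≮N) w
    ... | l , l<k , v = rec l<k v

2^-distance : ∀ {N} → Graph N → Fin N → Fin N → ℚ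
2^-distance G i j with distance G i j
... | inj₁ (d , _) = 2^ (ℤ.- (+ d))
... | inj₂ _       = 0ℚ

closeness : ∀ {N} → Graph N → ℚ
closeness {N} G =
  ∑[ i < N ] ∑[ j < N ] (if does (j Fin.≟ i) then 0ℚ else 2^-distance G i j)

-- `label i` is the k for which the vertex i is called vₖ, counting from 1.
label : ∀ {N} → Fin N → ℕ
label i = suc (toℕ i)

CliqueLink : ℕ → Rel ℕ 0ℓ
CliqueLink m a b = a ≢ b × a ≤ m × b ≤ m

BridgeLink : ℕ → Rel ℕ 0ℓ
BridgeLink m a b = a ≡ m × b ≡ suc m

-- The links (v_{m+i}, v_{m+i+1}) with i ≥ 1; the bound i ≤ n - 1 is implied
-- by labels being at most m + n.
PathLink : ℕ → Rel ℕ 0ℓ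
PathLink m a b = m < a × b ≡ suc a

Link : ℕ → Rel ℕ 0ℓ
Link m a b = CliqueLink m a b ⊎ BridgeLink m a b ⊎ PathLink m a b

link? : ∀ m → Decidable (Link m)
link? m a b =
  (¬? (a ℕ.≟ b) ×-dec (a ℕ.≤? m) ×-dec (b ℕ.≤? m)) ⊎-dec
  ((a ℕ.≟ m) ×-dec (b ℕ.≟ suc m)) ⊎-dec
  ((m ℕ.<? a) ×-dec (b ℕ.≟ suc a))

link-irrefl : ∀ m {a} → ¬ Link m a a
link-irrefl m (inj₁ (a≢a , _))               = a≢a refl
link-irrefl m (inj₂ (inj₁ (refl , ())))
link-irrefl m (inj₂ (inj₂ (_ , ())))

lollipop : ∀ m n → Graph (m ℕ.+ n)
lollipop m n = record
  { Adj    = λ i j → Link m (label i) (label j) ⊎ Link m (label j) (label i)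
  ; adj?   = λ i j → link? m (label i) (label j) ⊎-dec link? m (label j) (label i)
  ; symm   = λ { (inj₁ l) → inj₂ l ; (inj₂ l) → inj₁ l }
  ; irrefl = λ { refl (inj₁ l) → link-irrefl m l ; refl (inj₂ l) → link-irrefl m l }
  }

{-# OPTIONS --safe #-}

-- Writing m = k + 2 and numbering the vertices from 0, the map x ↦ x ⊔ k
-- collapses all clique vertices except the bridgehead k + 1, and
-- d(x , y) = 1 ⊔ ∣ x ⊔ k - y ⊔ k ∣ for x ≠ y: links move x ⊔ k by at most 1.
-- Adding vertex N to the vertices below it raises the closeness by 2 r(N), where
-- r(N) is the sum of 2^(- d(x , N)) over x < N; r(N) = N / 2 for N < m and
-- r(N + 1) = (r(N) + 1) / 2 for N ≥ m - 1, so both sums have closed forms.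

module Submission where

open import Defs
open import Algebra.Bundles using (module Ring)
open import Data.Bool.Base using (if_then_else_)
open import Data.Fin.Base as Fin using (Fin; toℕ; fromℕ<)
open import Data.Fin.Properties as Fin using (toℕ<n; toℕ-injective; toℕ-fromℕ<)
open import Data.Integer.Base as ℤ using (+_)
import Data.Integer.Properties as ℤ
open import Data.Nat.Base as ℕ using (ℕ; zero; suc; _≥_; _≤_; _<_; z≤n; s≤s; ∣_-_∣; _⊔_; _∸_)
import Data.Nat.Properties as ℕ
open import Data.Product.Base using (_,_)
open import Data.Rational.Base
  using (ℚ; 0ℚ; 1ℚ; ½; _+_; _*_; _-_; _÷_; toℚᵘ; +-*-rawSemiring)
import Data.Rational.Properties as ℚ
open import Data.Rational.Solver using (module +-*-Solver)
open import Data.Rational.Unnormalised.Base as ℚᵘ using (mkℚᵘ; *≡*)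
import Data.Rational.Unnormalised.Properties as ℚᵘ
open import Data.Sum.Base using (inj₁; inj₂; [_,_]′)
open import Function.Base using (_∘_)
open import Relation.Binary.Definitions using (tri<; tri≈; tri>)
open import Relation.Binary.PropositionalEquality
  using (_≡_; _≢_; refl; sym; trans; cong; cong₂; subst; subst₂; module ≡-Reasoning)
open import Relation.Nullary using (yes; no; does; contradiction)
open import Relation.Nullary.Decidable using (dec-true; dec-false)

open import Algebra.Definitions.RawSemiring +-*-rawSemiring using (_^_)
open import Algebra.Properties.CommutativeMonoid.Sum ℚ.+-0-commutativeMonoid
  using (sum-syntax; sum-cong-≗; ∑-distrib-+)
open import Algebra.Properties.Semiring.Sum (Ring.semiring ℚ.+-*-ring) using (*-distribˡ-sum)

open +-*-Solver using (solve; _:=_; _:+_; _:*_; _:-_; con)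

-- Numerals and powers of two in ℚ.

fromℕ-suc : ∀ n → fromℕ (suc n) ≡ 1ℚ + fromℕ n
fromℕ-suc n = ℚ.toℚᵘ-injective (begin
  toℚᵘ (fromℕ (suc n))          ≈⟨ ℚ.toℚᵘ-fromℚᵘ (mkℚᵘ (+ suc n) 0) ⟩
  mkℚᵘ (+ suc n) 0              ≈⟨ *≡* (cong (λ z → (+ 1 ℤ.+ z) ℤ.* + 1) (sym (ℤ.*-identityʳ (+ n)))) ⟩
  toℚᵘ 1ℚ ℚᵘ.+ mkℚᵘ (+ n) 0     ≈⟨ ℚᵘ.+-congʳ (toℚᵘ 1ℚ) (ℚ.toℚᵘ-fromℚᵘ (mkℚᵘ (+ n) 0)) ⟨
  toℚᵘ 1ℚ ℚᵘ.+ toℚᵘ (fromℕ n)   ≈⟨ ℚ.toℚᵘ-homo-+ 1ℚ (fromℕ n) ⟨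
  toℚᵘ (1ℚ + fromℕ n)           ∎)
  where open ℚᵘ.≃-Reasoning

2^-neg : ∀ d → 2^ (ℤ.- (+ d)) ≡ ½ ^ d
2^-neg zero    = refl
2^-neg (suc d) = refl

-- The exponent is positive at 0, zero at 1 and negative afterwards, and `2^_` computes only once
-- the case is known.
2^-1-n : ∀ n → 2^ (+ 1 ℤ.- + n) ≡ fromℕ 2 * ½ ^ n
2^-1-n 0             = refl
2^-1-n 1             = refl
2^-1-n (suc (suc n)) =
  solve 1 (λ q → con ½ :* q := con (fromℕ 2) :* (con ½ :* (con ½ :* q))) refl (½ ^ n)

-- Sums over initial segments of ℕ.

Σ< : ℕ → (ℕ → ℚ) → ℚ
Σ< N f = ∑[ i < N ] f (toℕ i)

Σ<-suc : ∀ N f → Σ< (suc N) f ≡ Σ< N f + f N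
Σ<-suc zero    f = ℚ.+-comm (f 0) 0ℚ
Σ<-suc (suc N) f = trans (cong (λ s → f 0 + s) (Σ<-suc N (f ∘ suc))) (sym (ℚ.+-assoc (f 0) _ _))

Σ<-cong : ∀ N {f g : ℕ → ℚ} → (∀ {x} → x < N → f x ≡ g x) → Σ< N f ≡ Σ< N g
Σ<-cong N f≡g = sum-cong-≗ (λ i → f≡g (toℕ<n i))

Σ<-const : ∀ N q → Σ< N (λ _ → q) ≡ fromℕ N * q
Σ<-const zero    q = sym (ℚ.*-zeroˡ q)
Σ<-const (suc N) q = begin
  q + Σ< N (λ _ → q)    ≡⟨ cong (λ s → q + s) (Σ<-const N q) ⟩
  q + fromℕ N * q       ≡⟨ solve 2 (λ x y → x :+ y :* x := (con 1ℚ :+ y) :* x) refl q (fromℕ N) ⟩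
  (1ℚ + fromℕ N) * q    ≡⟨ cong (_* q) (fromℕ-suc N) ⟨
  fromℕ (suc N) * q     ∎
  where open ≡-Reasoning

-- Enlarging the square adds a row and a column, which have equal sums by symmetry, and a corner on
-- the diagonal, which vanishes.
Σ<-square : ∀ (f : ℕ → ℕ → ℚ) → (∀ x y → f x y ≡ f y x) → (∀ x → f x x ≡ 0ℚ) → ∀ N →
  Σ< (suc N) (λ x → Σ< (suc N) (f x)) ≡
  Σ< N (λ x → Σ< N (f x)) + fromℕ 2 * Σ< N (λ x → f x N)
Σ<-square f f-sym f-diag N = begin
  Σ< (suc N) (λ x → Σ< (suc N) (f x))
    ≡⟨ Σ<-suc N (λ x → Σ< (suc N) (f x)) ⟩
  Σ< N (λ x → Σ< (suc N) (f x)) + Σ< (suc N) (f N)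
    ≡⟨ cong₂ _+_ (Σ<-cong N (λ {x} _ → Σ<-suc N (f x))) (Σ<-suc N (f N)) ⟩
  Σ< N (λ x → Σ< N (f x) + f x N) + (Σ< N (f N) + f N N)
    ≡⟨ cong₂ _+_ (∑-distrib-+ {N} (λ i → Σ< N (f (toℕ i))) (λ i → f (toℕ i) N))
                 (cong₂ _+_ (Σ<-cong N (λ {x} _ → f-sym N x)) (f-diag N)) ⟩
  (S + R) + (R + 0ℚ)
    ≡⟨ solve 2 (λ s r → (s :+ r) :+ (r :+ con 0ℚ) := s :+ con (fromℕ 2) :* r) refl S R ⟩
  S + fromℕ 2 * R ∎
  where
  open ≡-Reasoning
  S = Σ< N (λ x → Σ< N (f x))
  R = Σ< N (λ x → f x N)

-- Walks and distances in an arbitrary graph.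

module _ {N} {G : Graph N} where
  open Graph G

  snoc : ∀ {n i j l} → Walk G n i j → Adj j l → Walk G (suc n) i l
  snoc []      b = b ∷ []
  snoc (a ∷ w) b = a ∷ snoc w b

  reverse : ∀ {n i j} → Walk G n i j → Walk G n j i
  reverse []      = []
  reverse (a ∷ w) = snoc (reverse w) (symm a)

  1≤length : ∀ {n i j} → i ≢ j → Walk G n i j → 1 ≤ n
  1≤length i≢j []      = contradiction refl i≢j
  1≤length i≢j (a ∷ w) = s≤s z≤n

  -- Whatever length the search in `distance` returns, minimality on both sides forces it to be `d`;
  -- the walk of length `d` excludes the disconnected outcome.
  2^-distance-unique : ∀ {i j d} → IsDistance G i j d → 2^-distance G i j ≡ ½ ^ d
  2^-distance-unique {i} {j} {d} (w , min) with distance G i j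
  ... | inj₁ (e , v , min′) =
    trans (2^-neg e) (cong (½ ^_) (ℕ.≤-antisym (min′ d w) (min e v)))
  ... | inj₂ ¬conn          = contradiction (d , w) ¬conn

-- The distance formula and its weights on natural numbers.

module _ (k : ℕ) where

  gap : ℕ → ℕ → ℕ
  gap x y = ∣ x ⊔ k - y ⊔ k ∣

  -- The maximum with 1 corrects the gap 0 between distinct vertices up to `k`. On the diagonal it
  -- gives 1, so this is a distance for distinct vertices only.
  dist : ℕ → ℕ → ℕ
  dist x y = 1 ⊔ gap x y

  gap-comm : ∀ x y → gap x y ≡ gap y x
  gap-comm x y = ℕ.∣-∣-comm (x ⊔ k) (y ⊔ k)

  private
    ∣-∣≤1 : ∀ {p q} → p ≤ suc q → q ≤ suc p → ∣ p - q ∣ ≤ 1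
    ∣-∣≤1 {zero}  {q}     _         q≤1       = q≤1
    ∣-∣≤1 {suc p} {zero}  p≤1       _         = p≤1
    ∣-∣≤1 {suc p} {suc q} (s≤s p≤q) (s≤s q≤p) = ∣-∣≤1 p≤q q≤p

  -- On the clique `x ⊔ k` takes only the values `k` and `suc k`.
  gap-clique : ∀ {x y} → x ≤ suc k → y ≤ suc k → gap x y ≤ 1
  gap-clique {x} {y} x≤ y≤ = ∣-∣≤1 (below x≤ y) (below y≤ x)
    where
    below : ∀ {x} → x ≤ suc k → ∀ y → x ⊔ k ≤ suc (y ⊔ k)
    below x≤ y = ℕ.⊔-lub (ℕ.≤-trans x≤ (s≤s (ℕ.m≤n⊔m y k)))
                         (ℕ.m≤n⇒m≤1+n (ℕ.m≤n⊔m y k))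

  gap-suc : ∀ x → gap x (suc x) ≤ 1
  gap-suc x = ∣-∣≤1
    (ℕ.m≤n⇒m≤1+n (ℕ.⊔-monoˡ-≤ k (ℕ.n≤1+n x)))
    (ℕ.⊔-lub (s≤s (ℕ.m≤m⊔n x k)) (ℕ.m≤n⇒m≤1+n (ℕ.m≤n⊔m x k)))

  dist-near : ∀ {x y} → gap x y ≤ 1 → dist x y ≡ 1
  dist-near = ℕ.m≥n⇒m⊔n≡m

  -- Beyond `k` the target is not truncated, and it exceeds `x ⊔ k`, so the formula reduces to the
  -- difference `y ∸ (x ⊔ k)`, which grows with `y`.
  dist-step : ∀ {x y} → x < y → suc k ≤ y → dist x (suc y) ≡ suc (dist x y)
  dist-step {x} {y} x<y k<y = begin
    1 ⊔ gap x (suc y)       ≡⟨ dist-far (ℕ.m≤n⇒m≤1+n x<y) (ℕ.m≤n⇒m≤1+n k<y) ⟩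
    suc y ∸ (x ⊔ k)         ≡⟨ ℕ.+-∸-assoc 1 (ℕ.<⇒≤ (ℕ.⊔-pres-<m x<y k<y)) ⟩
    suc (y ∸ (x ⊔ k))       ≡⟨ cong suc (dist-far x<y k<y) ⟨
    suc (1 ⊔ gap x y)       ∎
    where
    open ≡-Reasoning
    dist-far : ∀ {y} → x < y → k < y → dist x y ≡ y ∸ (x ⊔ k)
    dist-far {y} x<y k<y = begin
      1 ⊔ ∣ x ⊔ k - y ⊔ k ∣   ≡⟨ cong (λ z → 1 ⊔ ∣ x ⊔ k - z ∣) (ℕ.m≥n⇒m⊔n≡m (ℕ.<⇒≤ k<y)) ⟩
      1 ⊔ ∣ x ⊔ k - y ∣       ≡⟨ cong (1 ⊔_) (ℕ.m≤n⇒∣m-n∣≡n∸m (ℕ.<⇒≤ x⊔k<y)) ⟩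
      1 ⊔ (y ∸ (x ⊔ k))       ≡⟨ ℕ.m≤n⇒m⊔n≡n (ℕ.m<n⇒0<n∸m x⊔k<y) ⟩
      y ∸ (x ⊔ k)             ∎
      where
      x⊔k<y : x ⊔ k < y
      x⊔k<y = ℕ.⊔-pres-<m x<y k<y

  -- Mirrors the summand of `closeness` with an explicit distance. Using ℕ instead of `Fin` lets the
  -- same function serve for every number of vertices, as the induction on that number requires.
  weight : ℕ → ℕ → ℚ
  weight x y = if does (y ℕ.≟ x) then 0ℚ else ½ ^ dist x y

  weight-diag : ∀ x → weight x x ≡ 0ℚ
  weight-diag x rewrite dec-true (x ℕ.≟ x) refl = refl

  weight-off : ∀ {x y} → y ≢ x → weight x y ≡ ½ ^ dist x y
  weight-off {x} {y} y≢x rewrite dec-false (y ℕ.≟ x) y≢x = refl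

  weight-near : ∀ {x y} → x < y → gap x y ≤ 1 → weight x y ≡ ½
  weight-near {x} {y} x<y g = trans (weight-off (ℕ.>⇒≢ x<y)) (cong (½ ^_) (dist-near {x} {y} g))

  weight-sym : ∀ x y → weight x y ≡ weight y x
  weight-sym x y with x ℕ.≟ y
  ... | yes refl = refl
  ... | no x≢y   = begin
    weight x y      ≡⟨ weight-off (x≢y ∘ sym) ⟩
    ½ ^ dist x y    ≡⟨ cong (λ g → ½ ^ (1 ⊔ g)) (gap-comm x y) ⟩
    ½ ^ dist y x    ≡⟨ weight-off x≢y ⟨
    weight y x      ∎
    where open ≡-Reasoning

  weight-step : ∀ {x y} → x < y → suc k ≤ y → weight x (suc y) ≡ ½ * weight x y
  weight-step {x} {y} x<y k<y = begin
    weight x (suc y)     ≡⟨ weight-off (ℕ.>⇒≢ (ℕ.m≤n⇒m≤1+n x<y)) ⟩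
    ½ ^ dist x (suc y)   ≡⟨ cong (½ ^_) (dist-step x<y k<y) ⟩
    ½ * ½ ^ dist x y     ≡⟨ cong (½ *_) (weight-off (ℕ.>⇒≢ x<y)) ⟨
    ½ * weight x y       ∎
    where open ≡-Reasoning

  -- Row sums and totals of the weights.

  row : ℕ → ℚ
  row N = Σ< N (λ x → weight x N)

  total : ℕ → ℚ
  total N = Σ< N (λ x → Σ< N (weight x))

  row-clique : ∀ {N} → N ≤ suc k → row N ≡ fromℕ N * ½
  row-clique {N} N≤ = trans
    (Σ<-cong N (λ x<N → weight-near x<N (gap-clique (ℕ.≤-trans (ℕ.<⇒≤ x<N) N≤) N≤)))
    (Σ<-const N ½)

  -- Moving the target from `N` to `suc N` halves each old term; the additional ½ comes from the
  -- neighbour `N`.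
  row-step : ∀ {N} → suc k ≤ N → row (suc N) ≡ ½ * row N + ½
  row-step {N} k<N = begin
    row (suc N)
      ≡⟨ Σ<-suc N (λ x → weight x (suc N)) ⟩
    Σ< N (λ x → weight x (suc N)) + weight N (suc N)
      ≡⟨ cong₂ _+_ (Σ<-cong N (λ x<N → weight-step x<N k<N)) (weight-near {N} ℕ.≤-refl (gap-suc N)) ⟩
    Σ< N (λ x → ½ * weight x N) + ½
      ≡⟨ cong (_+ ½) (*-distribˡ-sum {N} ½ (λ i → weight (toℕ i) N)) ⟨
    ½ * row N + ½ ∎
    where open ≡-Reasoning

  total-suc : ∀ N → total (suc N) ≡ total N + fromℕ 2 * row N
  total-suc = Σ<-square weight weight-sym weight-diag

  -- Each ordered pair of distinct clique vertices contributes ½.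
  total-clique : ∀ {N} → N ≤ suc (suc k) → total N ≡ fromℕ N * (fromℕ N - 1ℚ) * ½
  total-clique {zero}  _         = refl
  total-clique {suc N} (s≤s N≤) = begin
    total (suc N)
      ≡⟨ total-suc N ⟩
    total N + fromℕ 2 * row N
      ≡⟨ cong₂ (λ t r → t + fromℕ 2 * r) (total-clique (ℕ.m≤n⇒m≤1+n N≤)) (row-clique N≤) ⟩
    q * (q - 1ℚ) * ½ + fromℕ 2 * (q * ½)
      ≡⟨ solve 1 (λ x → x :* (x :- con 1ℚ) :* con ½ :+ con (fromℕ 2) :* (x :* con ½)
                     := (con 1ℚ :+ x) :* ((con 1ℚ :+ x) :- con 1ℚ) :* con ½) refl q ⟩
    (1ℚ + q) * ((1ℚ + q) - 1ℚ) * ½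
      ≡⟨ cong (λ s → s * (s - 1ℚ) * ½) (fromℕ-suc N) ⟨
    fromℕ (suc N) * (fromℕ (suc N) - 1ℚ) * ½ ∎
    where
    open ≡-Reasoning
    q = fromℕ N

  -- Closed forms along the path.

  private
    m : ℕ
    m = suc (suc k)

    M : ℚ
    M = fromℕ m

  -- The recursion of `row-step` has fixed point 1, and the deviation from it is halved at each
  -- step. At the first path vertex this deviation is `(M - 3) / 4`.
  row-path : ∀ n → row (m ℕ.+ n) ≡ 1ℚ + (M - fromℕ 3) * ½ * ½ * ½ ^ n
  row-path zero = begin
    row (m ℕ.+ 0)                       ≡⟨ cong row (ℕ.+-identityʳ m) ⟩
    row m                               ≡⟨ row-step ℕ.≤-refl ⟩
    ½ * row (suc k) + ½                 ≡⟨ cong (λ r → ½ * r + ½) (row-clique ℕ.≤-refl) ⟩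
    ½ * (c * ½) + ½
      ≡⟨ solve 1 (λ x → con ½ :* (x :* con ½) :+ con ½
             := con 1ℚ :+ ((con 1ℚ :+ x) :- con (fromℕ 3)) :* con ½ :* con ½ :* con 1ℚ) refl c ⟩
    1ℚ + ((1ℚ + c) - fromℕ 3) * ½ * ½ * 1ℚ
      ≡⟨ cong (λ s → 1ℚ + (s - fromℕ 3) * ½ * ½ * 1ℚ) (fromℕ-suc (suc k)) ⟨
    1ℚ + (M - fromℕ 3) * ½ * ½ * 1ℚ     ∎
    where
    open ≡-Reasoning
    c = fromℕ (suc k)
  row-path (suc n) = begin
    row (m ℕ.+ suc n)                   ≡⟨ cong row (ℕ.+-suc m n) ⟩
    row (suc (m ℕ.+ n))                 ≡⟨ row-step (ℕ.m≤n⇒m≤1+n (ℕ.m≤m+n (suc k) n)) ⟩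
    ½ * row (m ℕ.+ n) + ½               ≡⟨ cong (λ r → ½ * r + ½) (row-path n) ⟩
    ½ * (1ℚ + (M - fromℕ 3) * ½ * ½ * ½ ^ n) + ½
      ≡⟨ solve 2 (λ x p → con ½ :* (con 1ℚ :+ (x :- con (fromℕ 3)) :* con ½ :* con ½ :* p) :+ con ½
             := con 1ℚ :+ (x :- con (fromℕ 3)) :* con ½ :* con ½ :* (con ½ :* p)) refl M (½ ^ n) ⟩
    1ℚ + (M - fromℕ 3) * ½ * ½ * (½ * ½ ^ n) ∎
    where open ≡-Reasoning

  -- The increments `2 * row` add up to `2 * n` plus a geometric series with sum
  -- `(M - 3) * (1 - ½ ^ n)`; added to the clique total and regrouped, this is the right-hand side.
  total-path : ∀ n → total (m ℕ.+ n) ≡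
    M * (M + 1ℚ - fromℕ 2 * ½ ^ n) * ½ + fromℕ 2 * fromℕ n + fromℕ 3 * ½ ^ n - fromℕ 3
  total-path zero = begin
    total (m ℕ.+ 0)      ≡⟨ cong total (ℕ.+-identityʳ m) ⟩
    total m              ≡⟨ total-clique ℕ.≤-refl ⟩
    M * (M - 1ℚ) * ½
      ≡⟨ solve 1 (λ x → x :* (x :- con 1ℚ) :* con ½
             := x :* (x :+ con 1ℚ :- con (fromℕ 2) :* con 1ℚ) :* con ½
                :+ con (fromℕ 2) :* con 0ℚ :+ con (fromℕ 3) :* con 1ℚ :- con (fromℕ 3)) refl M ⟩
    M * (M + 1ℚ - fromℕ 2 * 1ℚ) * ½ + fromℕ 2 * 0ℚ + fromℕ 3 * 1ℚ - fromℕ 3 ∎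
    where open ≡-Reasoning
  total-path (suc n) = begin
    total (m ℕ.+ suc n)                          ≡⟨ cong total (ℕ.+-suc m n) ⟩
    total (suc (m ℕ.+ n))                        ≡⟨ total-suc (m ℕ.+ n) ⟩
    total (m ℕ.+ n) + fromℕ 2 * row (m ℕ.+ n)
      ≡⟨ cong₂ (λ t r → t + fromℕ 2 * r) (total-path n) (row-path n) ⟩
    (M * (M + 1ℚ - fromℕ 2 * p) * ½ + fromℕ 2 * q + fromℕ 3 * p - fromℕ 3)
      + fromℕ 2 * (1ℚ + (M - fromℕ 3) * ½ * ½ * p)
      ≡⟨ solve 3 (λ x y z →
           (x :* (x :+ con 1ℚ :- con (fromℕ 2) :* z) :* con ½
              :+ con (fromℕ 2) :* y :+ con (fromℕ 3) :* z :- con (fromℕ 3))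
             :+ con (fromℕ 2) :* (con 1ℚ :+ (x :- con (fromℕ 3)) :* con ½ :* con ½ :* z)
           := x :* (x :+ con 1ℚ :- con (fromℕ 2) :* (con ½ :* z)) :* con ½
              :+ con (fromℕ 2) :* (con 1ℚ :+ y) :+ con (fromℕ 3) :* (con ½ :* z)
              :- con (fromℕ 3)) refl M q p ⟩
    M * (M + 1ℚ - fromℕ 2 * (½ * p)) * ½ + fromℕ 2 * (1ℚ + q) + fromℕ 3 * (½ * p) - fromℕ 3
      ≡⟨ cong (λ s → M * (M + 1ℚ - fromℕ 2 * (½ * p)) * ½ + fromℕ 2 * s + fromℕ 3 * (½ * p) - fromℕ 3)
              (fromℕ-suc n) ⟨
    M * (M + 1ℚ - fromℕ 2 * (½ * p)) * ½ + fromℕ 2 * fromℕ (suc n) + fromℕ 3 * (½ * p) - fromℕ 3 ∎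
    where
    open ≡-Reasoning
    p = ½ ^ n
    q = fromℕ n

  -- Distances in the lollipop graph.

  link⇒gap≤1 : ∀ {x y} → Link m (suc x) (suc y) → gap x y ≤ 1
  link⇒gap≤1     (inj₁ (_ , s≤s x≤ , s≤s y≤))  = gap-clique x≤ y≤
  link⇒gap≤1     (inj₂ (inj₁ (refl , refl)))   = gap-suc (suc k)
  link⇒gap≤1 {x} (inj₂ (inj₂ (_ , refl)))      = gap-suc x

  -- The link leaving the bridgehead `suc k` is the bridge; all later ones are path links.
  suc-link : ∀ {x} → suc k ≤ x → Link m (suc x) (suc (suc x))
  suc-link {x} k<x with suc k ℕ.≟ x
  ... | yes refl = inj₂ (inj₁ (refl , refl))
  ... | no k+1≢x = inj₂ (inj₂ (s≤s (ℕ.≤∧≢⇒< k<x k+1≢x) , refl))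

  module _ (n : ℕ) where

    private
      G : Graph (m ℕ.+ n)
      G = lollipop m n

    -- The lower bound for the distance: `gap` satisfies the triangle inequality and is at most 1
    -- across a link.
    gap≤length : ∀ {l i j} → Walk G l i j → gap (toℕ i) (toℕ j) ≤ l
    gap≤length {i = i} [] = ℕ.≤-reflexive (ℕ.∣n-n∣≡0 (toℕ i ⊔ k))
    gap≤length {i = i} {j} (_∷_ {j = h} a w) = ℕ.≤-trans
      (ℕ.∣-∣-triangle (toℕ i ⊔ k) (toℕ h ⊔ k) (toℕ j ⊔ k))
      (ℕ.+-mono-≤
        ([ link⇒gap≤1 , (λ l → ℕ.≤-trans (ℕ.≤-reflexive (gap-comm (toℕ i) (toℕ h))) (link⇒gap≤1 l)) ]′ a)
        (gap≤length w))

    -- The upper bound: walk down the path one vertex at a time until a single link reaches `i`.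
    -- Keeping `toℕ j` as a separate `y` makes the recursion structural.
    descent : ∀ {y} (j i : Fin (m ℕ.+ n)) → toℕ j ≡ y → toℕ i < y → Walk G (dist (toℕ i) y) j i
    descent {suc y} j i j≡ (s≤s i≤y) with suc y ℕ.≤? suc k
    -- Both ends lie in the clique, so one clique link suffices.
    ... | yes y≤k = subst (λ l → Walk G l j i)
      (sym (dist-near {toℕ i} {suc y} (gap-clique (ℕ.≤-trans i≤y (ℕ.<⇒≤ y≤k)) y≤k)))
      (inj₂ (inj₁ ((λ e → ℕ.<⇒≢ (s≤s i≤y) (trans (ℕ.suc-injective e) j≡))
                  , s≤s (ℕ.≤-trans i≤y (ℕ.<⇒≤ y≤k))
                  , s≤s (subst (_≤ suc k) (sym j≡) y≤k))) ∷ [])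
    ... | no y≰k with ℕ.m≤n⇒m<n∨m≡n i≤y
    -- Here `i` is the predecessor of `j`; this case stands apart because `dist-step` needs `i`
    -- strictly below `y`.
    ...   | inj₂ refl = subst (λ l → Walk G l j i)
      (sym (dist-near {toℕ i} {suc (toℕ i)} (gap-suc (toℕ i))))
      (inj₂ (subst (λ z → Link m (label i) (suc z)) (sym j≡) (suc-link (ℕ.≤-pred (ℕ.≰⇒> y≰k)))) ∷ [])
    ...   | inj₁ i<y = subst (λ l → Walk G l j i)
      (sym (dist-step i<y k<y))
      (inj₂ (subst₂ (λ x z → Link m (suc x) (suc z)) (sym h≡) (sym j≡) (suc-link k<y))
        ∷ descent h i h≡ i<y)
      where
      k<y : suc k ≤ y
      k<y = ℕ.≤-pred (ℕ.≰⇒> y≰k)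
      y<N : y < m ℕ.+ n
      y<N = ℕ.<-trans (ℕ.n<1+n y) (subst (_< m ℕ.+ n) j≡ (toℕ<n j))
      h : Fin (m ℕ.+ n)
      h = fromℕ< y<N
      h≡ : toℕ h ≡ y
      h≡ = toℕ-fromℕ< y<N

    geodesic : ∀ {i j} → i ≢ j → Walk G (dist (toℕ i) (toℕ j)) i j
    geodesic {i} {j} i≢j with ℕ.<-cmp (toℕ i) (toℕ j)
    ... | tri< i<j _ _ = reverse (descent j i refl i<j)
    ... | tri≈ _ i≡j _ = contradiction (toℕ-injective i≡j) i≢j
    ... | tri> _ _ j<i = subst (λ g → Walk G (1 ⊔ g) i j) (gap-comm (toℕ j) (toℕ i))
                               (descent i j refl j<i)

    dist-isDistance : ∀ {i j} → i ≢ j → IsDistance G i j (dist (toℕ i) (toℕ j))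
    dist-isDistance i≢j = geodesic i≢j , λ l w → ℕ.⊔-lub (1≤length i≢j w) (gap≤length w)

    closeness-lollipop : closeness G ≡ total (m ℕ.+ n)
    closeness-lollipop = sum-cong-≗ (λ i → sum-cong-≗ (term i))
      where
      term : ∀ i j → (if does (j Fin.≟ i) then 0ℚ else 2^-distance G i j) ≡ weight (toℕ i) (toℕ j)
      term i j with j Fin.≟ i
      ... | yes refl = sym (weight-diag (toℕ i))
      ... | no j≢i   = trans (2^-distance-unique (dist-isDistance (j≢i ∘ sym)))
                             (sym (weight-off (j≢i ∘ toℕ-injective)))

theorem1 : (m n : ℕ) → m ≥ 3 → n ≥ 1 →
    closeness (lollipop m n) ≡
    fromℕ m * (fromℕ m + 1ℚ - 2^ (+ 1 ℤ.- + n)) ÷ fromℕ 2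
    + fromℕ 2 * fromℕ n + fromℕ 3 * 2^ (ℤ.- (+ n)) - fromℕ 3
theorem1 m@(suc (suc k)) n _ _ = begin
  closeness (lollipop m n)
    ≡⟨ closeness-lollipop k n ⟩
  total k (m ℕ.+ n)
    -- Division by `fromℕ 2` computes to multiplication by ½, so the two closed forms agree
    -- definitionally.
    ≡⟨ total-path k n ⟩
  formula (fromℕ 2 * ½ ^ n) (½ ^ n)
    ≡⟨ cong₂ formula (2^-1-n n) (2^-neg n) ⟨
  formula (2^ (+ 1 ℤ.- + n)) (2^ (ℤ.- (+ n))) ∎
  where
  open ≡-Reasoning
  formula : ℚ → ℚ → ℚ
  formula a b =
    fromℕ m * (fromℕ m + 1ℚ - a) ÷ fromℕ 2 + fromℕ 2 * fromℕ n + fromℕ 3 * b - fromℕ 3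
theorem1 1 n (s≤s ())
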